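{- For every integer $i\ge 1$, the sequence $\{d_i(m)\}_{m\ge i}$ is strictly ratio-log-convex; that is, for every $i\ge 1$ and every $m\ge i+2$, $$\left(\frac{d_i(m)}{d_i(m-1)}\right)^2<\frac{d_i(m-1)}{d_i(m-2)}\cdot\frac{d_i(m+1)}{d_i(m)}.$$
   Context: For integers $m\ge 0$ and $0\le i\le m$, the Boros–Moll numbers are $$d_i(m)=2^{ -2m}\sum_{k=i}^{m}2^k\binom{2m-2k}{m-k}\binom{m+k}{k}\binom{k}{i}.$$ -}

module Defs where

open import Data.Integer.Base using (+_)
open import Data.List.Base using (applyUpTo)
open import Data.Nat.Base using (ℕ; zero; suc; _+_; _*_; _∸_; _^_; _≤_; _<_; z≤n; s≤s; >-nonZero)
open import Data.Nat.Combinatorics using (_C_; nCk+nC[k+1]≡[n+1]C[k+1])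
open import Data.Nat.Properties using (m^n≢0; m^n>0; m≤m+n; m≤n+m; ≤-refl; ≤-trans; *-mono-≤; *-distribˡ-∸; +-∸-assoc; +-identityʳ; m+n≤o⇒m≤o∸n; ∸-monoʳ-≤)
open import Data.Nat.ListAction using (sum)
open import Data.Rational.Base as ℚ using (ℚ; _÷_)
open import Data.Rational.Properties using (normalize-pos; pos⇒nonZero)
open import Relation.Binary.PropositionalEquality using (subst)

-- ∑ a b f = f a + f (a + 1) + … + f b, which is empty when b < a.
∑ : ℕ → ℕ → (ℕ → ℕ) → ℕ
∑ a b f = sum (applyUpTo (λ j → f (a + j)) (suc b ∸ a))

dTerm : ℕ → ℕ → ℕ → ℕ
dTerm i m k = 2 ^ k * ((2 * m ∸ 2 * k) C (m ∸ k)) * ((m + k) C k) * (k C i)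

-- The Boros–Moll number d_i(m) for i ≤ m; for m < i the value is 0.
d : ℕ → ℕ → ℚ
d i m = ℚ._/_ (+ ∑ i m (dTerm i m)) (2 ^ (2 * m)) {{m^n≢0 2 (2 * m)}}

C-pos : ∀ {n k} → k ≤ n → 0 < n C k
C-pos {n} {zero} z≤n = s≤s z≤n
C-pos {suc n} {suc k} (s≤s k≤n) =
  subst (0 <_) (nCk+nC[k+1]≡[n+1]C[k+1] n k) (≤-trans (C-pos k≤n) (m≤m+n _ _))

dTerm-pos : ∀ {i m} → i ≤ m → 0 < dTerm i m i
dTerm-pos {i} {m} i≤m =
  *-mono-≤ (*-mono-≤ (*-mono-≤ (m^n>0 2 i) (C-pos m-i≤2m-2i)) (C-pos (m≤n+m i m))) (C-pos (≤-refl {i}))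
  where
  m-i≤2m-2i : m ∸ i ≤ 2 * m ∸ 2 * i
  m-i≤2m-2i = subst (m ∸ i ≤_) (*-distribˡ-∸ 2 m i) (m≤m+n (m ∸ i) _)

∑-pos : ∀ {a b} (f : ℕ → ℕ) → a ≤ b → 0 < f a → 0 < ∑ a b f
∑-pos {a} {b} f a≤b fa>0 rewrite +-∸-assoc 1 a≤b | +-identityʳ a = ≤-trans fa>0 (m≤m+n _ _)

d-nonZero : ∀ {i m} → i ≤ m → ℚ.NonZero (d i m)
d-nonZero {i} {m} i≤m = pos⇒nonZero (d i m) {{normalize-pos _ _ {{m^n≢0 2 (2 * m)}} {{>-nonZero (∑-pos (dTerm i m) i≤m (dTerm-pos i≤m))}}}}

-- d_i(m) / d_i(n); the proof i ≤ n serves only to make the denominator nonzero.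
dRatio : (i m n : ℕ) → .(i ≤ n) → ℚ
dRatio i m n i≤n = _÷_ (d i m) (d i n) {{d-nonZero i≤n}}

i+2≤m⇒i≤m∸2 : ∀ {i m} → i + 2 ≤ m → i ≤ m ∸ 2
i+2≤m⇒i≤m∸2 {i} {m} = m+n≤o⇒m≤o∸n i

i+2≤m⇒i≤m∸1 : ∀ {i m} → i + 2 ≤ m → i ≤ m ∸ 1
i+2≤m⇒i≤m∸1 {i} {m} h = ≤-trans (i+2≤m⇒i≤m∸2 {i} {m} h) (∸-monoʳ-≤ m (s≤s z≤n))

i+2≤m⇒i≤m : ∀ {i m} → i + 2 ≤ m → i ≤ m
i+2≤m⇒i≤m {i} h = ≤-trans (m≤m+n i 2) h

{-# OPTIONS --safe #-}

-- Zeilberger's algorithm gives a three-term recurrence for d_i(m) in m. Hence the ratio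
-- r = d_i(m) / d_i(m-1) determines both of its neighbours, and the claim becomes the
-- positivity at r of a quartic polynomial whose coefficients are rational in i and m.
-- The recurrence also propagates, by induction on m, the lower bound r ≥ L with
--   L = m (4i² + 4m - 1) / (2 (m-i) (i² + m)).
-- Expanding the quartic at L, all coefficients of its powers of r - L turn out to be
-- positive: with i = 1 + j and m = i + 1 + n, clearing denominators leaves polynomials in
-- j and n with only nonnegative coefficients.
module Submission where

open import Defs
open import Data.Bool.Base using (Bool; true; _∧_; T)
open import Data.Bool.Properties using (T-∧)
import Data.Integer.Base as ℤ
import Data.Integer.Properties as ℤ
open import Data.List.Base using (List; []; _∷_; map; applyUpTo)
open import Data.Nat.Base
open import Data.Nat.Combinatorics using (_C_; k>n⇒nCk≡0; nCk≡nC[n∸k]; nCk+nC[k+1]≡[n+1]C[k+1])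
open import Data.Nat.ListAction using (sum)
open import Data.Nat.Properties
open import Data.Nat.Tactic.RingSolver using (solve-∀)
open import Data.Product.Base using (_,_)
import Data.Rational.Base as ℚ
import Data.Rational.Properties as ℚ
open import Data.Rational.Solver using (module +-*-Solver)
open import Data.Rational.Unnormalised.Base as ℚᵘ using (mkℚᵘ; *<*)
import Data.Rational.Unnormalised.Properties as ℚᵘ
open import Function.Bundles using (Equivalence)
open import Relation.Binary.PropositionalEquality using (_≡_; refl; sym; trans; cong; cong₂; subst; subst₂; module ≡-Reasoning)

-- Coefficientwise comparison of polynomials in two variables

-- Keeping the coefficients abstract lets `polynomials` be iterated, so one development yields both
-- `ℕ[X]` and `ℕ[X][Y]`.
record Coefficients : Set₁ where
  infixl 6 _⊞_
  infixl 7 _⊠_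
  infix 4 _≼_
  field
    Coeff : Set
    𝟘     : Coeff
    _⊞_   : Coeff → Coeff → Coeff
    _⊠_   : Coeff → Coeff → Coeff
    _≼_   : Coeff → Coeff → Bool

-- Comparison has to be sound only: `≼` is a Boolean test whose success forces the inequality at
-- every point.
record Evaluation (R : Coefficients) : Set where
  open Coefficients R
  field
    eval   : Coeff → ℕ
    eval-𝟘 : eval 𝟘 ≡ 0
    eval-⊞ : ∀ a b → eval (a ⊞ b) ≡ eval a + eval b
    eval-⊠ : ∀ a b → eval (a ⊠ b) ≡ eval a * eval b
    eval-≼ : ∀ a b → T (a ≼ b) → eval a ≤ eval b

ℕ-coefficients : Coefficients
ℕ-coefficients = record { Coeff = ℕ ; 𝟘 = 0 ; _⊞_ = _+_ ; _⊠_ = _*_ ; _≼_ = _≤ᵇ_ }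

ℕ-evaluation : Evaluation ℕ-coefficients
ℕ-evaluation = record
  { eval   = λ a → a
  ; eval-𝟘 = refl
  ; eval-⊞ = λ _ _ → refl
  ; eval-⊠ = λ _ _ → refl
  ; eval-≼ = ≤ᵇ⇒≤
  }

-- Polynomials in one variable over R: dense coefficient lists, constant term first.
module _ (R : Coefficients) where
  open Coefficients R

  add : List Coeff → List Coeff → List Coeff
  add []      q       = q
  add (a ∷ p) []      = a ∷ p
  add (a ∷ p) (b ∷ q) = a ⊞ b ∷ add p q

  mul : List Coeff → List Coeff → List Coeff
  mul []      q = []
  mul (a ∷ p) q = add (map (a ⊠_) q) (𝟘 ∷ mul p q)

  leq : List Coeff → List Coeff → Bool
  leq []      q       = true
  -- Lists are not trimmed, so the left one may be longer; its surplus entries must then lie below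
  -- `𝟘`.
  leq (a ∷ p) []      = (a ≼ 𝟘) ∧ leq p []
  leq (a ∷ p) (b ∷ q) = (a ≼ b) ∧ leq p q

  polynomials : Coefficients
  polynomials = record { Coeff = List Coeff ; 𝟘 = [] ; _⊞_ = add ; _⊠_ = mul ; _≼_ = leq }

module _ {R : Coefficients} (E : Evaluation R) (x : ℕ) where
  open Coefficients R
  open Evaluation E

  horner : List Coeff → ℕ
  horner []      = 0
  horner (a ∷ p) = eval a + x * horner p

  horner-add : ∀ p q → horner (add R p q) ≡ horner p + horner q
  horner-add []      q       = refl
  horner-add (a ∷ p) []      = sym (+-identityʳ _)
  horner-add (a ∷ p) (b ∷ q) = trans
    (cong₂ (λ u v → u + x * v) (eval-⊞ a b) (horner-add p q))
    (rearrange (eval a) (eval b) x (horner p) (horner q))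
    where
    rearrange : ∀ a b x p q → a + b + x * (p + q) ≡ a + x * p + (b + x * q)
    rearrange = solve-∀

  horner-scale : ∀ a q → horner (map (a ⊠_) q) ≡ eval a * horner q
  horner-scale a []      = sym (*-zeroʳ (eval a))
  horner-scale a (b ∷ q) = trans
    (cong₂ (λ u v → u + x * v) (eval-⊠ a b) (horner-scale a q))
    (rearrange (eval a) (eval b) x (horner q))
    where
    rearrange : ∀ a b x q → a * b + x * (a * q) ≡ a * (b + x * q)
    rearrange = solve-∀

  horner-mul : ∀ p q → horner (mul R p q) ≡ horner p * horner q
  horner-mul []      q = refl
  horner-mul (a ∷ p) q = trans (horner-add (map (a ⊠_) q) (𝟘 ∷ mul R p q)) (trans
    (cong₂ _+_ (horner-scale a q) (cong₂ (λ u v → u + x * v) eval-𝟘 (horner-mul p q)))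
    (rearrange (eval a) x (horner p) (horner q)))
    where
    rearrange : ∀ a x p q → a * q + (0 + x * (p * q)) ≡ (a + x * p) * q
    rearrange = solve-∀

  horner-leq : ∀ p q → T (leq R p q) → horner p ≤ horner q
  horner-leq []      q       _ = z≤n
  horner-leq (a ∷ p) []      h with Equivalence.to T-∧ h
  ... | a≼0 , p≼0 = subst (_≤ 0) (cong₂ _+_ (sym (n≤0⇒n≡0 (subst (eval a ≤_) eval-𝟘 (eval-≼ a 𝟘 a≼0)))) (cong (x *_) (sym p≡0)))
                      (≤-reflexive (*-zeroʳ x))
    where
    p≡0 : horner p ≡ 0
    p≡0 = n≤0⇒n≡0 (horner-leq p [] p≼0)
  horner-leq (a ∷ p) (b ∷ q) h with Equivalence.to T-∧ h
  ... | a≼b , p≼q = +-mono-≤ (eval-≼ a b a≼b) (*-monoʳ-≤ x (horner-leq p q p≼q))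

  evaluate : Evaluation (polynomials R)
  evaluate = record
    { eval   = horner
    ; eval-𝟘 = refl
    ; eval-⊞ = horner-add
    ; eval-⊠ = horner-mul
    ; eval-≼ = horner-leq
    }

-- Reflected expressions in two variables and their normal forms

ℕ[X] ℕ[X][Y] : Coefficients
ℕ[X]    = polynomials ℕ-coefficients
ℕ[X][Y] = polynomials ℕ[X]

infixl 6 _⊕_
infixl 7 _⊗_

-- Subtraction is absent: a polynomial is shown nonnegative by comparing its positive part with its
-- negative part.
data Expr : Set where
  con     : ℕ → Expr
  X Y     : Expr
  _⊕_ _⊗_ : Expr → Expr → Expr

⟦_⟧ : Expr → ℕ → ℕ → ℕ
⟦ con c ⟧ x y = c
⟦ X ⟧     x y = x
⟦ Y ⟧     x y = y
⟦ e ⊕ f ⟧ x y = ⟦ e ⟧ x y + ⟦ f ⟧ x y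
⟦ e ⊗ f ⟧ x y = ⟦ e ⟧ x y * ⟦ f ⟧ x y

open Coefficients ℕ[X][Y] using (_⊞_; _⊠_; _≼_)

normalise : Expr → List (List ℕ)
normalise (con c) = (c ∷ []) ∷ []
normalise X       = (0 ∷ 1 ∷ []) ∷ []
normalise Y       = [] ∷ (1 ∷ []) ∷ []
normalise (e ⊕ f) = normalise e ⊞ normalise f
normalise (e ⊗ f) = normalise e ⊠ normalise f

module _ (x y : ℕ) where
  open Evaluation (evaluate (evaluate ℕ-evaluation x) y)

  normalise-correct : ∀ e → eval (normalise e) ≡ ⟦ e ⟧ x y
  normalise-correct (con c) = rearrange c x y
    where
    rearrange : ∀ c x y → c + x * 0 + y * 0 ≡ c
    rearrange = solve-∀
  normalise-correct X = rearrange x y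
    where
    rearrange : ∀ x y → 0 + x * (1 + x * 0) + y * 0 ≡ x
    rearrange = solve-∀
  normalise-correct Y = rearrange x y
    where
    rearrange : ∀ x y → 0 + y * (1 + x * 0 + y * 0) ≡ y
    rearrange = solve-∀
  normalise-correct (e ⊕ f) = trans (eval-⊞ (normalise e) (normalise f)) (cong₂ _+_ (normalise-correct e) (normalise-correct f))
  normalise-correct (e ⊗ f) = trans (eval-⊠ (normalise e) (normalise f)) (cong₂ _*_ (normalise-correct e) (normalise-correct f))

  -- For closed `e` and `f` the test computes to `true`, so the implicit argument has the unit type
  -- and is filled in by itself.
  coefficientwise-≤ : ∀ e f → {T (normalise e ≼ normalise f)} → ⟦ e ⟧ x y ≤ ⟦ f ⟧ x y
  coefficientwise-≤ e f {e≼f} = subst₂ _≤_ (normalise-correct e) (normalise-correct f) (eval-≼ (normalise e) (normalise f) e≼f)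

-- Binomial coefficients and Catalan numbers

-- Pascal's rule splits the left side. One copy of `suc n C suc k` is set aside, the induction
-- hypotheses at `k` and `suc k` treat the rest, and Pascal's rule recombines the result.
absorption : ∀ n k → suc k * (suc n C suc k) ≡ suc n * (n C k)
absorption zero zero = refl
absorption zero (suc k) = trans (cong (suc (suc k) *_) (k>n⇒nCk≡0 {1} {suc (suc k)} (s≤s (s≤s z≤n))))
  (trans (*-zeroʳ (suc (suc k))) (sym (trans (*-identityˡ (0 C suc k)) (k>n⇒nCk≡0 {0} {suc k} (s≤s z≤n)))))
absorption (suc n) zero = trans (cong (1 *_) (sym (nCk+nC[k+1]≡[n+1]C[k+1] (suc n) 0))) (trans (*-distribˡ-+ 1 1 (suc n C 1)) (cong (1 +_) (absorption n 0)))
absorption (suc n) (suc k) = begin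
  suc (suc k) * (suc (suc n) C suc (suc k)) ≡⟨ cong (suc (suc k) *_) (sym (nCk+nC[k+1]≡[n+1]C[k+1] (suc n) (suc k))) ⟩
  suc (suc k) * ((suc n C suc k) + (suc n C suc (suc k))) ≡⟨ split k (suc n C suc k) (suc n C suc (suc k)) ⟩
  (suc n C suc k) + (suc k * (suc n C suc k) + suc (suc k) * (suc n C suc (suc k))) ≡⟨ cong ((suc n C suc k) +_) (cong₂ _+_ (absorption n k) (absorption n (suc k))) ⟩
  (suc n C suc k) + (suc n * (n C k) + suc n * (n C suc k)) ≡⟨ cong ((suc n C suc k) +_) (sym (*-distribˡ-+ (suc n) (n C k) (n C suc k))) ⟩
  (suc n C suc k) + suc n * ((n C k) + (n C suc k)) ≡⟨ cong (λ c → (suc n C suc k) + suc n * c) (nCk+nC[k+1]≡[n+1]C[k+1] n k) ⟩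
  suc (suc n) * (suc n C suc k) ∎
  where
  open ≡-Reasoning
  split : ∀ k a b → suc (suc k) * (a + b) ≡ a + (suc k * a + suc (suc k) * b)
  split = solve-∀

C-sym : ∀ k r → (k + r) C k ≡ (k + r) C r
C-sym k r = trans (nCk≡nC[n∸k] (m≤m+n k r)) (cong ((k + r) C_) (m+n∸m≡n k r))

-- This is `absorption` for the complementary lower index `r`, carried over by symmetry.
upper-absorption : ∀ k r → suc r * (suc (k + r) C k) ≡ suc (k + r) * ((k + r) C k)
upper-absorption k r = begin
  suc r * (suc (k + r) C k)      ≡⟨ cong (λ m → suc r * (m C k)) (sym (+-suc k r)) ⟩
  suc r * ((k + suc r) C k)      ≡⟨ cong (suc r *_) (C-sym k (suc r)) ⟩
  suc r * ((k + suc r) C suc r)  ≡⟨ cong (λ m → suc r * (m C suc r)) (+-suc k r) ⟩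
  suc r * (suc (k + r) C suc r)  ≡⟨ absorption (k + r) r ⟩
  suc (k + r) * ((k + r) C r)    ≡⟨ cong (suc (k + r) *_) (sym (C-sym k r)) ⟩
  suc (k + r) * ((k + r) C k)    ∎
  where open ≡-Reasoning

central : ℕ → ℕ
central r = (2 * r) C r

central-suc : ∀ r → suc r * central (suc r) ≡ 2 * (1 + 2 * r) * central r
-- `absorption` uses up one factor `suc r`; the extra one feeds `upper-absorption`.
central-suc r = *-cancelˡ-≡ _ _ (suc r) (begin
  suc r * (suc r * ((2 * suc r) C suc r))       ≡⟨ cong (λ m → suc r * (suc r * (m C suc r))) (double-suc r) ⟩
  suc r * (suc r * (suc (suc (r + r)) C suc r)) ≡⟨ cong (suc r *_) (absorption (suc (r + r)) r) ⟩
  suc r * (suc (suc (r + r)) * (suc (r + r) C r)) ≡⟨ swap r (suc (r + r) C r) ⟩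
  suc (suc (r + r)) * (suc r * (suc (r + r) C r)) ≡⟨ cong (suc (suc (r + r)) *_) (upper-absorption r r) ⟩
  suc (suc (r + r)) * (suc (r + r) * ((r + r) C r)) ≡⟨ regroup r ((r + r) C r) ⟩
  suc r * (2 * (1 + 2 * r) * ((r + r) C r))     ≡⟨ cong (λ m → suc r * (2 * (1 + 2 * r) * (m C r))) (cong (r +_) (sym (+-identityʳ r))) ⟩
  suc r * (2 * (1 + 2 * r) * central r)         ∎)
  where
  open ≡-Reasoning
  double-suc : ∀ r → 2 * suc r ≡ suc (suc (r + r))
  double-suc = solve-∀
  swap : ∀ r c → suc r * (suc (suc (r + r)) * c) ≡ suc (suc (r + r)) * (suc r * c)
  swap = solve-∀
  regroup : ∀ r c → suc (suc (r + r)) * (suc (r + r) * c) ≡ suc r * (2 * (1 + 2 * r) * c)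
  regroup = solve-∀

-- The Catalan number as a difference of neighbouring binomial coefficients, which avoids dividing
-- `central r` by `suc r`.
catalan : ℕ → ℕ
catalan r = central r ∸ (2 * r) C suc r

catalan-central : ∀ r → suc r * catalan r ≡ central r
catalan-central r = begin
  suc r * (central r ∸ (2 * r) C suc r)           ≡⟨ *-distribˡ-∸ (suc r) (central r) ((2 * r) C suc r) ⟩
  suc r * central r ∸ suc r * ((2 * r) C suc r)   ≡⟨ cong (suc r * central r ∸_) below ⟩
  central r + r * central r ∸ r * central r       ≡⟨ m+n∸n≡m (central r) (r * central r) ⟩
  central r                                       ∎
  where
  open ≡-Reasoning
  regroup : ∀ r c → suc (2 * r) * c ≡ suc r * c + r * c
  regroup = solve-∀
  -- By Pascal's rule the two neighbours add up to `suc (2 * r) C suc r`, which `absorption`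
  -- evaluates.
  below : suc r * ((2 * r) C suc r) ≡ r * central r
  below = +-cancelˡ-≡ (suc r * central r) _ _ (begin
    suc r * central r + suc r * ((2 * r) C suc r) ≡⟨ *-distribˡ-+ (suc r) (central r) ((2 * r) C suc r) ⟨
    suc r * (central r + (2 * r) C suc r)         ≡⟨ cong (suc r *_) (nCk+nC[k+1]≡[n+1]C[k+1] (2 * r) r) ⟩
    suc r * (suc (2 * r) C suc r)                 ≡⟨ absorption (2 * r) r ⟩
    suc (2 * r) * central r                       ≡⟨ regroup r (central r) ⟩
    suc r * central r + r * central r             ∎)

central-suc-catalan : ∀ r → central (suc r) ≡ 2 * (1 + 2 * r) * catalan r
central-suc-catalan r = *-cancelˡ-≡ _ _ (suc r) (begin
  suc r * central (suc r)                   ≡⟨ central-suc r ⟩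
  2 * (1 + 2 * r) * central r               ≡⟨ cong (2 * (1 + 2 * r) *_) (catalan-central r) ⟨
  2 * (1 + 2 * r) * (suc r * catalan r)     ≡⟨ swap r (catalan r) ⟩
  suc r * (2 * (1 + 2 * r) * catalan r)     ∎)
  where
  open ≡-Reasoning
  swap : ∀ r c → 2 * (1 + 2 * r) * (suc r * c) ≡ suc r * (2 * (1 + 2 * r) * c)
  swap = solve-∀

catalan-suc : ∀ r → (2 + r) * catalan (suc r) ≡ 2 * (1 + 2 * r) * catalan r
catalan-suc r = trans (catalan-central (suc r)) (central-suc-catalan r)

sum-applyUpTo-suc : ∀ f n → sum (applyUpTo f (suc n)) ≡ sum (applyUpTo f n) + f n
sum-applyUpTo-suc f zero    = +-identityʳ (f 0)
sum-applyUpTo-suc f (suc n) = trans (cong (f 0 +_) (sum-applyUpTo-suc (λ t → f (suc t)) n)) (sym (+-assoc (f 0) _ _))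

-- Naming m - k as `r` removes truncated subtraction; a free `s` lets the summands for M, M + 1 and
-- M + 2 take upper indices that are successors of `k + M`.
dTerm-split : ∀ i {m k} r s → k + r ≡ m → k + m ≡ s → dTerm i m k ≡ 2 ^ k * central r * (s C k) * (k C i)
dTerm-split i {k = k} r s refl refl = cong (_* (k C i)) (cong₂ _*_
  (cong (2 ^ k *_) (cong₂ _C_ (trans (sym (*-distribˡ-∸ 2 (k + r) k)) (cong (2 *_) (m+n∸m≡n k r))) (m+n∸m≡n k r)))
  (cong (_C k) (+-comm (k + r) k)))

-- The recurrence in m

-- From here on i = suc j and m = j + n, so that n counts the terms of d_i(m);
-- k = suc j + t is the summation index, and scaled j n = 4^m d_i(m).
partialSum : ℕ → ℕ → ℕ → ℕ
partialSum j m n = sum (applyUpTo (λ t → dTerm (suc j) m (suc j + t)) n)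

scaled : ℕ → ℕ → ℕ
scaled j n = partialSum j (j + n) n

partialSum-suc : ∀ j m t → partialSum j m (suc t) ≡ partialSum j m t + dTerm (suc j) m (suc j + t)
partialSum-suc j m t = sum-applyUpTo-suc (λ t → dTerm (suc j) m (suc j + t)) t

-- midCoeff j n = 8m² + 24m + 19 - 4i², written without subtraction.
midCoeff lowCoeff : ℕ → ℕ → ℕ
midCoeff j n = (3 + 2 * j) * (5 + 2 * j) + 8 * n * (3 + 2 * j + n)
lowCoeff j n = 4 * (2 + j + (j + n)) * (3 + 4 * (j + n)) * (5 + 4 * (j + n))

-- certificate is the output of Zeilberger's algorithm, with r = n - t; its rational factor
-- has poles that combine with the central binomial coefficient into the Catalan number.
certFactor : ℕ → ℕ → ℕ → ℕ
certFactor j k r = 2 * (k + r) * (r * r) + 2 * (1 + j) * r * (2 * k + r) + 2 * (k + r) * r + 2 * (k * k) + 2 * (1 + j) * (k + r) + (1 + 2 * j) * k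

certificate : ℕ → ℕ → ℕ → ℕ → ℕ → ℕ
certificate j M k t r = 4 * t * certFactor j k r * (2 ^ k * catalan r * ((k + M) C k) * (k C suc j))

-- This is `telescoping-step` without the factor `2 ^ k * u * c`, for `z = catalan r` and
-- `w = catalan (suc r)`. Multiplying by `2 + r` lets the Catalan recurrence eliminate `w`, and a
-- polynomial identity remains.
certFactor-identity : ∀ j t r z w → (2 + r) * w ≡ 2 * (1 + 2 * r) * z →
  let n = t + suc r ; M = j + n ; k = suc j + t in
  (1 + n) * (2 + (k + M)) * (1 + (k + M)) * (2 * (1 + 2 * suc r) * w) + lowCoeff j n * (suc r * z) + 4 * t * certFactor j k (suc r) * w
  ≡ 2 * midCoeff j n * (1 + (k + M)) * (2 * (1 + 2 * r) * z) + 8 * certFactor j (suc k) r * (1 + (k + M)) * z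
certFactor-identity j t r z w h = *-cancelˡ-≡ _ _ (2 + r) (begin
  (2 + r) * ((1 + n) * (2 + (k + M)) * (1 + (k + M)) * (2 * (1 + 2 * suc r) * w) + lowCoeff j n * (suc r * z) + 4 * t * certFactor j k (suc r) * w)
    ≡⟨ collect ((1 + n) * (2 + (k + M)) * (1 + (k + M))) (lowCoeff j n) (4 * t * certFactor j k (suc r)) r z w ⟩
  ((1 + n) * (2 + (k + M)) * (1 + (k + M)) * (2 * (1 + 2 * suc r)) + 4 * t * certFactor j k (suc r)) * ((2 + r) * w) + (2 + r) * (lowCoeff j n * suc r) * z
    ≡⟨ cong (λ v → ((1 + n) * (2 + (k + M)) * (1 + (k + M)) * (2 * (1 + 2 * suc r)) + 4 * t * certFactor j k (suc r)) * v + (2 + r) * (lowCoeff j n * suc r) * z) h ⟩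
  ((1 + n) * (2 + (k + M)) * (1 + (k + M)) * (2 * (1 + 2 * suc r)) + 4 * t * certFactor j k (suc r)) * (2 * (1 + 2 * r) * z) + (2 + r) * (lowCoeff j n * suc r) * z
    ≡⟨ polynomial j t r z ⟩
  (2 + r) * (2 * midCoeff j n * (1 + (k + M)) * (2 * (1 + 2 * r) * z) + 8 * certFactor j (suc k) r * (1 + (k + M)) * z) ∎)
  where
  open ≡-Reasoning
  n = t + suc r
  M = j + n
  k = suc j + t
  collect : ∀ a p s r z w → (2 + r) * (a * (2 * (1 + 2 * suc r) * w) + p * (suc r * z) + s * w)
    ≡ (a * (2 * (1 + 2 * suc r)) + s) * ((2 + r) * w) + (2 + r) * (p * suc r) * z
  collect = solve-∀
  -- `midCoeff`, `lowCoeff` and `certFactor` are unfolded, so that both sides are explicit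
  -- polynomials.
  polynomial : ∀ j t r z → let n = t + suc r ; M = j + n ; k = suc j + t in
    ((1 + n) * (2 + (k + M)) * (1 + (k + M)) * (2 * (1 + 2 * suc r)) + 4 * t * (2 * (k + suc r) * (suc r * suc r) + 2 * (1 + j) * suc r * (2 * k + suc r) + 2 * (k + suc r) * suc r + 2 * (k * k) + 2 * (1 + j) * (k + suc r) + (1 + 2 * j) * k)) * (2 * (1 + 2 * r) * z)
      + (2 + r) * (4 * (2 + j + (j + n)) * (3 + 4 * (j + n)) * (5 + 4 * (j + n)) * suc r) * z
    ≡ (2 + r) * (2 * ((3 + 2 * j) * (5 + 2 * j) + 8 * n * (3 + 2 * j + n)) * (1 + (k + M)) * (2 * (1 + 2 * r) * z) + 8 * (2 * (suc k + r) * (r * r) + 2 * (1 + j) * r * (2 * suc k + r) + 2 * (suc k + r) * r + 2 * (suc k * suc k) + 2 * (1 + j) * (suc k + r) + (1 + 2 * j) * suc k) * (1 + (k + M)) * z)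
  polynomial = solve-∀

-- At `k = M + 1` the sum for M has ended, so `lowCoeff` is absent. The Catalan and central binomial
-- numbers that occur are 1 and 2, which leaves polynomials.
certFactor-boundary : ∀ j n → let M = j + n ; k = suc j + n in
  2 * (1 + n) * (2 + (k + M)) * (1 + (k + M)) + 2 * (3 + (k + M)) * (2 + (k + M)) * (1 + (k + M)) + 4 * n * certFactor j k 0
  ≡ 2 * midCoeff j n * (1 + (k + M))
certFactor-boundary = polynomial
  where
  polynomial : ∀ j n → let M = j + n ; k = suc j + n in
    2 * (1 + n) * (2 + (k + M)) * (1 + (k + M)) + 2 * (3 + (k + M)) * (2 + (k + M)) * (1 + (k + M)) + 4 * n * (2 * (k + 0) * 0 + 2 * (1 + j) * 0 * (2 * k + 0) + 2 * (k + 0) * 0 + 2 * (k * k) + 2 * (1 + j) * (k + 0) + (1 + 2 * j) * k)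
    ≡ 2 * ((3 + 2 * j) * (5 + 2 * j) + 8 * n * (3 + 2 * j + n)) * (1 + (k + M))
  polynomial = solve-∀

-- For fixed `k`, the binomials of the three summands are rational multiples of `u`; this makes
-- `2 ^ k * u * c` a common factor of everything that is to telescope.
module Binomials (j n t : ℕ) where
  open ≡-Reasoning
  M k : ℕ
  M = j + n
  k = suc j + t

  u u₁ u₂ c : ℕ
  u  = (k + M) C k
  u₁ = suc (k + M) C k
  u₂ = suc (suc (k + M)) C k
  c  = k C suc j

  u₁-u : (1 + M) * u₁ ≡ (1 + (k + M)) * u
  u₁-u = upper-absorption k M

  u₂-u₁ : (2 + M) * u₂ ≡ (2 + (k + M)) * u₁
  u₂-u₁ = subst (λ s → (2 + M) * (suc s C k) ≡ suc s * (s C k)) (+-suc k M) (upper-absorption k (suc M))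

  u₂-u : (1 + M) * (2 + M) * u₂ ≡ (2 + (k + M)) * (1 + (k + M)) * u
  u₂-u = begin
    (1 + M) * (2 + M) * u₂               ≡⟨ *-assoc (1 + M) (2 + M) u₂ ⟩
    (1 + M) * ((2 + M) * u₂)             ≡⟨ cong ((1 + M) *_) u₂-u₁ ⟩
    (1 + M) * ((2 + (k + M)) * u₁)       ≡⟨ swap (1 + M) (2 + (k + M)) u₁ ⟩
    (2 + (k + M)) * ((1 + M) * u₁)       ≡⟨ cong ((2 + (k + M)) *_) u₁-u ⟩
    (2 + (k + M)) * ((1 + (k + M)) * u)  ≡⟨ *-assoc (2 + (k + M)) (1 + (k + M)) u ⟨
    (2 + (k + M)) * (1 + (k + M)) * u    ∎
    where
    swap : ∀ a b c → a * (b * c) ≡ b * (a * c)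
    swap = solve-∀

  -- The factor `suc k` produced by the second binomial is absorbed by the first. This brings
  -- quantities at `suc k` back to `k`, at the cost of the factor `suc t` that `certificate` carries
  -- there.
  next : ∀ s → suc t * ((suc s C suc k) * (suc k C suc j)) ≡ suc s * ((s C k) * c)
  next s = begin
    suc t * ((suc s C suc k) * (suc k C suc j)) ≡⟨ swap (suc t) (suc s C suc k) (suc k C suc j) ⟩
    (suc s C suc k) * (suc t * (suc k C suc j)) ≡⟨ cong ((suc s C suc k) *_) (upper-absorption (suc j) t) ⟩
    (suc s C suc k) * (suc k * c)               ≡⟨ regroup (suc s C suc k) (suc k) c ⟩
    suc k * (suc s C suc k) * c                 ≡⟨ cong (_* c) (absorption s k) ⟩
    suc s * (s C k) * c                         ≡⟨ *-assoc (suc s) (s C k) c ⟩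
    suc s * ((s C k) * c)                       ∎
    where
    swap : ∀ a b c → a * (b * c) ≡ b * (a * c)
    swap = solve-∀
    regroup : ∀ a b c → a * (b * c) ≡ b * a * c
    regroup = solve-∀

  -- The factors `1 + M` and `2 + M` turn `u₂` into `u`. The central binomial coefficient `b` stays
  -- free, to serve both inside the range and at its end.
  second-term : ∀ b → (1 + n) * (1 + M) * (2 + M) * (2 ^ k * b * u₂ * c)
    ≡ 2 ^ k * u * c * ((1 + n) * (2 + (k + M)) * (1 + (k + M)) * b)
  second-term b = begin
    (1 + n) * (1 + M) * (2 + M) * (2 ^ k * b * u₂ * c)       ≡⟨ regroup (1 + n) (1 + M) (2 + M) (2 ^ k) b u₂ c ⟩
    (1 + n) * (2 ^ k * b * c) * ((1 + M) * (2 + M) * u₂)     ≡⟨ cong ((1 + n) * (2 ^ k * b * c) *_) u₂-u ⟩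
    (1 + n) * (2 ^ k * b * c) * ((2 + (k + M)) * (1 + (k + M)) * u) ≡⟨ regroup′ (1 + n) (2 + (k + M)) (1 + (k + M)) (2 ^ k) b u c ⟩
    2 ^ k * u * c * ((1 + n) * (2 + (k + M)) * (1 + (k + M)) * b) ∎
    where
    regroup : ∀ n a a′ p b u c → n * a * a′ * (p * b * u * c) ≡ n * (p * b * c) * (a * a′ * u)
    regroup = solve-∀
    regroup′ : ∀ n a a′ p b u c → n * (p * b * c) * (a * a′ * u) ≡ p * u * c * (n * a * a′ * b)
    regroup′ = solve-∀

  first-term : ∀ b → 2 * (1 + M) * midCoeff j n * (2 ^ k * b * u₁ * c)
    ≡ 2 ^ k * u * c * (2 * midCoeff j n * (1 + (k + M)) * b)
  first-term b = begin
    2 * (1 + M) * midCoeff j n * (2 ^ k * b * u₁ * c)       ≡⟨ regroup (1 + M) (midCoeff j n) (2 ^ k) b u₁ c ⟩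
    2 * midCoeff j n * (2 ^ k * b * c) * ((1 + M) * u₁)     ≡⟨ cong (2 * midCoeff j n * (2 ^ k * b * c) *_) u₁-u ⟩
    2 * midCoeff j n * (2 ^ k * b * c) * ((1 + (k + M)) * u) ≡⟨ regroup′ (1 + (k + M)) (midCoeff j n) (2 ^ k) b u c ⟩
    2 ^ k * u * c * (2 * midCoeff j n * (1 + (k + M)) * b)   ∎
    where
    regroup : ∀ m a p b u c → 2 * m * a * (p * b * u * c) ≡ 2 * a * (p * b * c) * (m * u)
    regroup = solve-∀
    regroup′ : ∀ m a p b u c → 2 * a * (p * b * c) * (m * u) ≡ p * u * c * (2 * a * m * b)
    regroup′ = solve-∀

-- The recurrence operator applied to the summand is the forward difference of `certificate` in `k`,
-- with negative terms moved across.
telescoping-step : ∀ j t r → let n = t + suc r ; M = j + n ; k = suc j + t in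
  (1 + n) * (1 + M) * (2 + M) * dTerm (suc j) (j + suc (suc n)) k + lowCoeff j n * dTerm (suc j) M k + certificate j M k t (suc r)
  ≡ 2 * (1 + M) * midCoeff j n * dTerm (suc j) (j + suc n) k + certificate j M (suc k) (suc t) r
telescoping-step j t r = begin
  (1 + n) * (1 + M) * (2 + M) * dTerm (suc j) (j + suc (suc n)) k + lowCoeff j n * dTerm (suc j) M k + certificate j M k t (suc r)
    ≡⟨ cong₂ (λ x y → (1 + n) * (1 + M) * (2 + M) * x + lowCoeff j n * y + certificate j M k t (suc r))
         (dTerm-split (suc j) (suc (suc r)) (suc (suc (k + M))) (index₂ j t r) (index₂′ j t r))
         (dTerm-split (suc j) r (k + M) (index₀ j t r) refl) ⟩
  (1 + n) * (1 + M) * (2 + M) * (2 ^ k * central (suc (suc r)) * u₂ * c) + lowCoeff j n * (2 ^ k * central r * u * c) + certificate j M k t (suc r)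
    ≡⟨ cong₂ (λ x y → x + lowCoeff j n * (2 ^ k * y * u * c) + certificate j M k t (suc r))
         (trans (second-term (central (suc (suc r)))) (cong (λ b → 2 ^ k * u * c * ((1 + n) * (2 + (k + M)) * (1 + (k + M)) * b)) (central-suc-catalan (suc r))))
         (sym (catalan-central r)) ⟩
  2 ^ k * u * c * ((1 + n) * (2 + (k + M)) * (1 + (k + M)) * (2 * (1 + 2 * suc r) * w)) + lowCoeff j n * (2 ^ k * (suc r * z) * u * c) + 4 * t * certFactor j k (suc r) * (2 ^ k * w * u * c)
    ≡⟨ factor (2 ^ k) u c ((1 + n) * (2 + (k + M)) * (1 + (k + M)) * (2 * (1 + 2 * suc r) * w)) (lowCoeff j n) (suc r * z) (4 * t * certFactor j k (suc r)) w ⟩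
  2 ^ k * u * c * ((1 + n) * (2 + (k + M)) * (1 + (k + M)) * (2 * (1 + 2 * suc r) * w) + lowCoeff j n * (suc r * z) + 4 * t * certFactor j k (suc r) * w)
    ≡⟨ cong (2 ^ k * u * c *_) (certFactor-identity j t r z w (catalan-suc r)) ⟩
  2 ^ k * u * c * (2 * midCoeff j n * (1 + (k + M)) * (2 * (1 + 2 * r) * z) + 8 * certFactor j (suc k) r * (1 + (k + M)) * z)
    -- The 8 splits as 4 times 2, and the 2 completes `2 ^ suc k` in the shifted certificate.
    ≡⟨ unfactor (2 ^ k) u c (2 * midCoeff j n * (1 + (k + M)) * (2 * (1 + 2 * r) * z)) (certFactor j (suc k) r) (1 + (k + M)) z ⟩
  2 ^ k * u * c * (2 * midCoeff j n * (1 + (k + M)) * (2 * (1 + 2 * r) * z)) + 4 * certFactor j (suc k) r * (2 * 2 ^ k * z) * ((1 + (k + M)) * (u * c))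
    ≡⟨ cong₂ (λ x y → 2 ^ k * u * c * (2 * midCoeff j n * (1 + (k + M)) * x) + 4 * certFactor j (suc k) r * (2 * 2 ^ k * z) * y)
         (sym (central-suc-catalan r)) (sym (next (k + M))) ⟩
  2 ^ k * u * c * (2 * midCoeff j n * (1 + (k + M)) * central (suc r)) + 4 * certFactor j (suc k) r * (2 * 2 ^ k * z) * (suc t * ((suc (k + M) C suc k) * (suc k C suc j)))
    ≡⟨ cong₂ _+_ (sym (first-term (central (suc r)))) (regroup (certFactor j (suc k) r) (2 * 2 ^ k) z (suc t) (suc (k + M) C suc k) (suc k C suc j)) ⟩
  2 * (1 + M) * midCoeff j n * (2 ^ k * central (suc r) * u₁ * c) + certificate j M (suc k) (suc t) r
    ≡⟨ cong (λ x → 2 * (1 + M) * midCoeff j n * x + certificate j M (suc k) (suc t) r) (dTerm-split (suc j) (suc r) (suc (k + M)) (index₁ j t r) (index₁′ j t r)) ⟨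
  2 * (1 + M) * midCoeff j n * dTerm (suc j) (j + suc n) k + certificate j M (suc k) (suc t) r ∎
  where
  open ≡-Reasoning
  n = t + suc r
  open Binomials j n t
  z = catalan r
  w = catalan (suc r)
  index₀ : ∀ j t r → suc j + t + r ≡ j + (t + suc r)
  index₀ = solve-∀
  index₁ : ∀ j t r → suc j + t + suc r ≡ j + suc (t + suc r)
  index₁ = solve-∀
  index₂ : ∀ j t r → suc j + t + suc (suc r) ≡ j + suc (suc (t + suc r))
  index₂ = solve-∀
  index₁′ : ∀ j t r → suc j + t + (j + suc (t + suc r)) ≡ suc (suc j + t + (j + (t + suc r)))
  index₁′ = solve-∀
  index₂′ : ∀ j t r → suc j + t + (j + suc (suc (t + suc r))) ≡ suc (suc (suc j + t + (j + (t + suc r))))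
  index₂′ = solve-∀
  factor : ∀ p u c a q b s w → p * u * c * a + q * (p * b * u * c) + s * (p * w * u * c) ≡ p * u * c * (a + q * b + s * w)
  factor = solve-∀
  unfactor : ∀ p u c a s m z → p * u * c * (a + 8 * s * m * z) ≡ p * u * c * a + 4 * s * (2 * p * z) * (m * (u * c))
  unfactor = solve-∀
  regroup : ∀ s p z t v c → 4 * s * (p * z) * (t * (v * c)) ≡ 4 * t * s * (p * z * v * c)
  regroup = solve-∀

-- Summing the differences leaves the certificate at the upper end alone; at `t = 0` it vanishes
-- through its factor `t`.
telescoping : ∀ j n t r → t + r ≡ n → let M = j + n in
  (1 + n) * (1 + M) * (2 + M) * partialSum j (j + suc (suc n)) t + lowCoeff j n * partialSum j M t
  ≡ 2 * (1 + M) * midCoeff j n * partialSum j (j + suc n) t + certificate j M (suc j + t) t r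
telescoping j n zero r refl = zeros ((1 + n) * (1 + (j + n)) * (2 + (j + n))) (lowCoeff j n) (2 * (1 + (j + n)) * midCoeff j n)
  where
  zeros : ∀ a b c → a * 0 + b * 0 ≡ c * 0 + 0
  zeros = solve-∀
-- The rewriting turns `suc j + suc t` into `suc k`.
telescoping j n (suc t) r eq rewrite +-suc j t = begin
  a * partialSum j (j + suc (suc n)) (suc t) + lowCoeff j n * partialSum j M (suc t)
    ≡⟨ cong₂ (λ x y → a * x + lowCoeff j n * y) (partialSum-suc j (j + suc (suc n)) t) (partialSum-suc j M t) ⟩
  a * (partialSum j (j + suc (suc n)) t + F₂) + lowCoeff j n * (partialSum j M t + F₀)
    ≡⟨ regroup a (lowCoeff j n) (partialSum j (j + suc (suc n)) t) F₂ (partialSum j M t) F₀ ⟩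
  a * partialSum j (j + suc (suc n)) t + lowCoeff j n * partialSum j M t + (a * F₂ + lowCoeff j n * F₀)
    ≡⟨ cong (_+ (a * F₂ + lowCoeff j n * F₀)) (telescoping j n t (suc r) (trans (+-suc t r) eq)) ⟩
  b * partialSum j (j + suc n) t + certificate j M k t (suc r) + (a * F₂ + lowCoeff j n * F₀)
    ≡⟨ swap (b * partialSum j (j + suc n) t) (certificate j M k t (suc r)) (a * F₂ + lowCoeff j n * F₀) ⟩
  b * partialSum j (j + suc n) t + (a * F₂ + lowCoeff j n * F₀ + certificate j M k t (suc r))
    ≡⟨ cong (b * partialSum j (j + suc n) t +_) (step (trans (+-suc t r) eq)) ⟩
  b * partialSum j (j + suc n) t + (b * F₁ + certificate j M (suc k) (suc t) r)
    ≡⟨ collect b (partialSum j (j + suc n) t) F₁ (certificate j M (suc k) (suc t) r) ⟩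
  b * (partialSum j (j + suc n) t + F₁) + certificate j M (suc k) (suc t) r
    ≡⟨ cong (λ x → b * x + certificate j M (suc k) (suc t) r) (partialSum-suc j (j + suc n) t) ⟨
  b * partialSum j (j + suc n) (suc t) + certificate j M (suc k) (suc t) r ∎
  where
  open ≡-Reasoning
  M = j + n
  k = suc j + t
  a = (1 + n) * (1 + M) * (2 + M)
  b = 2 * (1 + M) * midCoeff j n
  F₀ = dTerm (suc j) M k
  F₁ = dTerm (suc j) (j + suc n) k
  F₂ = dTerm (suc j) (j + suc (suc n)) k
  step : t + suc r ≡ n → a * F₂ + lowCoeff j n * F₀ + certificate j M k t (suc r) ≡ b * F₁ + certificate j M (suc k) (suc t) r
  step refl = telescoping-step j t r
  regroup : ∀ a p x f y g → a * (x + f) + p * (y + g) ≡ a * x + p * y + (a * f + p * g)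
  regroup = solve-∀
  swap : ∀ x g y → x + g + y ≡ x + (y + g)
  swap = solve-∀
  collect : ∀ b x f g → b * x + (b * f + g) ≡ b * (x + f) + g
  collect = solve-∀

-- The sums for M + 1 and M + 2 run one and two terms further than that for M; these extra terms
-- balance the certificate left at the upper end.
telescoping-boundary : ∀ j n → let M = j + n ; k = suc j + n in
  (1 + n) * (1 + M) * (2 + M) * (dTerm (suc j) (j + suc (suc n)) k + dTerm (suc j) (j + suc (suc n)) (suc k)) + certificate j M k n 0
  ≡ 2 * (1 + M) * midCoeff j n * dTerm (suc j) (j + suc n) k
telescoping-boundary j n = begin
  a * (dTerm (suc j) (j + suc (suc n)) k + dTerm (suc j) (j + suc (suc n)) (suc k)) + certificate j M k n 0
    ≡⟨ cong₂ (λ x y → a * (x + y) + certificate j M k n 0)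
         (dTerm-split (suc j) 1 (suc (suc (k + M))) (index₂ j n) (index₂′ j n))
         (dTerm-split (suc j) 0 (suc (suc (suc (k + M)))) (index₃ j n) (index₃′ j n)) ⟩
  a * (2 ^ k * 2 * u₂ * c + 2 * 2 ^ k * 1 * v * c′) + 4 * n * certFactor j k 0 * (2 ^ k * 1 * u * c)
    ≡⟨ separate (1 + n) (1 + M) (2 + M) (2 ^ k) u₂ c v c′ (4 * n * certFactor j k 0 * (2 ^ k * 1 * u * c)) ⟩
  a * (2 ^ k * 2 * u₂ * c) + 2 * 2 ^ k * (1 + M) * (2 + M) * (suc n * (v * c′)) + 4 * n * certFactor j k 0 * (2 ^ k * 1 * u * c)
    ≡⟨ cong₂ (λ x y → x + y + 4 * n * certFactor j k 0 * (2 ^ k * 1 * u * c)) (second-term 2) last-term ⟩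
  2 ^ k * u * c * ((1 + n) * (2 + (k + M)) * (1 + (k + M)) * 2) + 2 * 2 ^ k * c * (3 + (k + M)) * ((2 + (k + M)) * (1 + (k + M)) * u) + 4 * n * certFactor j k 0 * (2 ^ k * 1 * u * c)
    ≡⟨ factor (2 ^ k) u c (1 + n) (3 + (k + M)) (2 + (k + M)) (1 + (k + M)) (4 * n * certFactor j k 0) ⟩
  2 ^ k * u * c * (2 * (1 + n) * (2 + (k + M)) * (1 + (k + M)) + 2 * (3 + (k + M)) * (2 + (k + M)) * (1 + (k + M)) + 4 * n * certFactor j k 0)
    ≡⟨ cong (2 ^ k * u * c *_) (certFactor-boundary j n) ⟩
  2 ^ k * u * c * (2 * midCoeff j n * (1 + (k + M)))
    ≡⟨ cong (2 ^ k * u * c *_) (*-identityʳ (2 * midCoeff j n * (1 + (k + M)))) ⟨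
  2 ^ k * u * c * (2 * midCoeff j n * (1 + (k + M)) * 1)
    ≡⟨ first-term 1 ⟨
  2 * (1 + M) * midCoeff j n * (2 ^ k * 1 * u₁ * c)
    ≡⟨ cong (2 * (1 + M) * midCoeff j n *_) (dTerm-split (suc j) 0 (suc (k + M)) (index₁ j n) (index₁′ j n)) ⟨
  2 * (1 + M) * midCoeff j n * dTerm (suc j) (j + suc n) k ∎
  where
  open ≡-Reasoning
  open Binomials j n n
  a = (1 + n) * (1 + M) * (2 + M)
  v = suc (suc (suc (k + M))) C suc k
  c′ = suc k C suc j
  last-term : 2 * 2 ^ k * (1 + M) * (2 + M) * (suc n * (v * c′)) ≡ 2 * 2 ^ k * c * (3 + (k + M)) * ((2 + (k + M)) * (1 + (k + M)) * u)
  last-term = begin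
    2 * 2 ^ k * (1 + M) * (2 + M) * (suc n * (v * c′))               ≡⟨ cong (2 * 2 ^ k * (1 + M) * (2 + M) *_) (next (suc (suc (k + M)))) ⟩
    2 * 2 ^ k * (1 + M) * (2 + M) * ((3 + (k + M)) * (u₂ * c))       ≡⟨ regroup (2 ^ k) (1 + M) (2 + M) (3 + (k + M)) u₂ c ⟩
    2 * 2 ^ k * c * (3 + (k + M)) * ((1 + M) * (2 + M) * u₂)         ≡⟨ cong (2 * 2 ^ k * c * (3 + (k + M)) *_) u₂-u ⟩
    2 * 2 ^ k * c * (3 + (k + M)) * ((2 + (k + M)) * (1 + (k + M)) * u) ∎
    where
    regroup : ∀ p m m′ s u c → 2 * p * m * m′ * (s * (u * c)) ≡ 2 * p * c * s * (m * m′ * u)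
    regroup = solve-∀
  index₁ : ∀ j n → suc j + n + 0 ≡ j + suc n
  index₁ = solve-∀
  index₂ : ∀ j n → suc j + n + 1 ≡ j + suc (suc n)
  index₂ = solve-∀
  index₃ : ∀ j n → suc (suc j + n) + 0 ≡ j + suc (suc n)
  index₃ = solve-∀
  index₁′ : ∀ j n → suc j + n + (j + suc n) ≡ suc (suc j + n + (j + n))
  index₁′ = solve-∀
  index₂′ : ∀ j n → suc j + n + (j + suc (suc n)) ≡ suc (suc (suc j + n + (j + n)))
  index₂′ = solve-∀
  index₃′ : ∀ j n → suc (suc j + n) + (j + suc (suc n)) ≡ suc (suc (suc (suc j + n + (j + n))))
  index₃′ = solve-∀
  separate : ∀ n m m′ p u c v c′ g → n * m * m′ * (p * 2 * u * c + 2 * p * 1 * v * c′) + g ≡ n * m * m′ * (p * 2 * u * c) + 2 * p * m * m′ * (n * (v * c′)) + g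
  separate = solve-∀
  factor : ∀ p u c n x y z s → p * u * c * (n * y * z * 2) + 2 * p * c * x * (y * z * u) + s * (p * 1 * u * c)
    ≡ p * u * c * (2 * n * y * z + 2 * x * y * z + s)
  factor = solve-∀

-- The leading coefficient keeps `1 + n` apart because `lower-bound` at `suc n` has the same factor.
recurrence : ∀ j n → let M = j + n in
  (1 + n) * ((1 + M) * (2 + M)) * scaled j (suc (suc n)) + lowCoeff j n * scaled j n ≡ 2 * (1 + M) * midCoeff j n * scaled j (suc n)
recurrence j n = begin
  (1 + n) * ((1 + M) * (2 + M)) * scaled j (suc (suc n)) + lowCoeff j n * scaled j n
    ≡⟨ cong (λ x → x * scaled j (suc (suc n)) + lowCoeff j n * scaled j n) (*-assoc (1 + n) (1 + M) (2 + M)) ⟨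
  a * scaled j (suc (suc n)) + lowCoeff j n * scaled j n
    ≡⟨ cong (λ x → a * x + lowCoeff j n * scaled j n) (trans (partialSum-suc j (j + suc (suc n)) (suc n)) (cong₂ _+_ (partialSum-suc j (j + suc (suc n)) n) (cong (dTerm (suc j) (j + suc (suc n))) (cong suc (+-suc j n))))) ⟩
  a * (partialSum j (j + suc (suc n)) n + F₂ + F₂′) + lowCoeff j n * scaled j n
    ≡⟨ regroup a (partialSum j (j + suc (suc n)) n) F₂ F₂′ (lowCoeff j n * scaled j n) ⟩
  a * partialSum j (j + suc (suc n)) n + lowCoeff j n * scaled j n + a * (F₂ + F₂′)
    ≡⟨ cong (_+ a * (F₂ + F₂′)) (telescoping j n n 0 (+-identityʳ n)) ⟩
  b * partialSum j (j + suc n) n + certificate j M k n 0 + a * (F₂ + F₂′)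
    ≡⟨ swap (b * partialSum j (j + suc n) n) (certificate j M k n 0) (a * (F₂ + F₂′)) ⟩
  b * partialSum j (j + suc n) n + (a * (F₂ + F₂′) + certificate j M k n 0)
    ≡⟨ cong (b * partialSum j (j + suc n) n +_) (telescoping-boundary j n) ⟩
  b * partialSum j (j + suc n) n + b * F₁
    ≡⟨ *-distribˡ-+ b (partialSum j (j + suc n) n) F₁ ⟨
  b * (partialSum j (j + suc n) n + F₁)
    ≡⟨ cong (b *_) (partialSum-suc j (j + suc n) n) ⟨
  b * scaled j (suc n) ∎
  where
  open ≡-Reasoning
  M = j + n
  k = suc j + n
  a = (1 + n) * (1 + M) * (2 + M)
  b = 2 * (1 + M) * midCoeff j n
  F₁ = dTerm (suc j) (j + suc n) k
  F₂ = dTerm (suc j) (j + suc (suc n)) k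
  F₂′ = dTerm (suc j) (j + suc (suc n)) (suc k)
  regroup : ∀ a x f f′ y → a * (x + f + f′) + y ≡ a * x + y + a * (f + f′)
  regroup = solve-∀
  swap : ∀ x g y → x + g + y ≡ x + (y + g)
  swap = solve-∀

-- The lower bound and the inequality for numerators

-- Expand in `t = y - l * x`. The three conditions bound the coefficients of orders 0, 1 and 2; the
-- last one also covers order 3, and the term of order 4 has a favourable sign.
quartic-< : ∀ α β γ δ l {x y} → 0 < x → l * x ≤ y →
  α * (l * l * l) + β < γ * l + δ * (l * l * l * l) →
  3 * α * (l * l) ≤ γ + 4 * δ * (l * l * l) →
  α ≤ 2 * δ * l →
  α * x * (y * y * y) + β * (x * x * x * x) < γ * (x * x * x) * y + δ * (y * y * y * y)
quartic-< α β γ δ l {suc x-1} {y} _ lx≤y h₀ h₁ h₂ = subst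
  (λ y → α * x * (y * y * y) + β * (x * x * x * x) < γ * (x * x * x) * y + δ * (y * y * y * y))
  (m+[n∸m]≡n lx≤y) (begin-strict
  α * x * (y′ * y′ * y′) + β * (x * x * x * x)
    ≡⟨ expandˡ α β l x t ⟩
  (α * (l * l * l) + β) * (x * x * x * x) + 3 * α * (l * l) * (x * x * x * t) + α * (3 * l * (x * x * t * t) + x * t * t * t)
    <⟨ +-mono-<-≤ (+-mono-<-≤ (*-monoˡ-< (x * x * x * x) h₀) (*-monoˡ-≤ (x * x * x * t) h₁)) (*-monoˡ-≤ (3 * l * (x * x * t * t) + x * t * t * t) h₂) ⟩
  (γ * l + δ * (l * l * l * l)) * (x * x * x * x) + (γ + 4 * δ * (l * l * l)) * (x * x * x * t) + 2 * δ * l * (3 * l * (x * x * t * t) + x * t * t * t)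
    ≤⟨ m≤m+n _ (2 * δ * l * (x * t * t * t) + δ * (t * t * t * t)) ⟩
  (γ * l + δ * (l * l * l * l)) * (x * x * x * x) + (γ + 4 * δ * (l * l * l)) * (x * x * x * t) + 2 * δ * l * (3 * l * (x * x * t * t) + x * t * t * t) + (2 * δ * l * (x * t * t * t) + δ * (t * t * t * t))
    ≡⟨ expandʳ γ δ l x t ⟨
  γ * (x * x * x) * y′ + δ * (y′ * y′ * y′ * y′) ∎)
  where
  open ≤-Reasoning
  x = suc x-1
  t = y ∸ l * x
  y′ = l * x + t
  expandˡ : ∀ α β l x t → let y = l * x + t in
    α * x * (y * y * y) + β * (x * x * x * x) ≡
    (α * (l * l * l) + β) * (x * x * x * x) + 3 * α * (l * l) * (x * x * x * t) + α * (3 * l * (x * x * t * t) + x * t * t * t)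
  expandˡ = solve-∀
  expandʳ : ∀ γ δ l x t → let y = l * x + t in
    γ * (x * x * x) * y + δ * (y * y * y * y) ≡
    (γ * l + δ * (l * l * l * l)) * (x * x * x * x) + (γ + 4 * δ * (l * l * l)) * (x * x * x * t) + 2 * δ * l * (3 * l * (x * x * t * t) + x * t * t * t) + (2 * δ * l * (x * t * t * t) + δ * (t * t * t * t))
  expandʳ = solve-∀

-- lower-bound says d_i(m+1) / d_i(m) ≥ (m+1)(4i²+4m+3) / (2(m+1-i)(i²+m+1)).
boundNum boundDen : ℕ → ℕ → ℕ
boundNum j n = 2 * (1 + (j + n)) * (3 + 4 * ((1 + j) * (1 + j) + (j + n)))
boundDen j n = 1 + (1 + j) * (1 + j) + (j + n)

-- ⟦ Aᴱ Y ⟧ j n, ⟦ Pᴱ Y ⟧ j n, ⟦ Lᴱ Y ⟧ j n and ⟦ Eᴱ Y ⟧ j n compute to midCoeff j n,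
-- lowCoeff j n, boundNum j n and boundDen j n.
Aᴱ Pᴱ Lᴱ Eᴱ : Expr → Expr
Aᴱ n = (con 3 ⊕ con 2 ⊗ X) ⊗ (con 5 ⊕ con 2 ⊗ X) ⊕ con 8 ⊗ n ⊗ (con 3 ⊕ con 2 ⊗ X ⊕ n)
Pᴱ n = con 4 ⊗ (con 2 ⊕ X ⊕ (X ⊕ n)) ⊗ (con 3 ⊕ con 4 ⊗ (X ⊕ n)) ⊗ (con 5 ⊕ con 4 ⊗ (X ⊕ n))
Lᴱ n = con 2 ⊗ (con 1 ⊕ (X ⊕ n)) ⊗ (con 3 ⊕ con 4 ⊗ ((con 1 ⊕ X) ⊗ (con 1 ⊕ X) ⊕ (X ⊕ n)))
Eᴱ n = con 1 ⊕ (con 1 ⊕ X) ⊗ (con 1 ⊕ X) ⊕ (X ⊕ n)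

sucᴱ : Expr → Expr
sucᴱ n = con 1 ⊕ n

-- The recurrence gives `x₂` in terms of `x₁` minus a multiple of `x₀`, and the old bound limits
-- `x₀` from above. Adding `e′ * p * (l * x₀)` to both sides avoids the subtraction.
bound-transfer : ∀ m l l′ e e′ p a n {x₀ x₁ x₂} .{{_ : NonZero m}} .{{_ : NonZero l}} →
  l * x₀ ≤ n * e * x₁ →
  (1 + n) * m * x₂ + p * x₀ ≡ a * x₁ →
  m * l * l′ + e * e′ * p * n ≤ a * e′ * l →
  l′ * x₁ ≤ (1 + n) * e′ * x₂
bound-transfer m l l′ e e′ p a n {x₀} {x₁} {x₂} lx₀≤ rec poly =
  *-cancelˡ-≤ (m * l) {{m*n≢0 m l}} (+-cancelʳ-≤ (e′ * p * (l * x₀)) _ _ (begin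
    m * l * (l′ * x₁) + e′ * p * (l * x₀)       ≤⟨ +-monoʳ-≤ (m * l * (l′ * x₁)) (*-monoʳ-≤ (e′ * p) lx₀≤) ⟩
    m * l * (l′ * x₁) + e′ * p * (n * e * x₁)   ≡⟨ collect m l l′ e e′ p n x₁ ⟩
    (m * l * l′ + e * e′ * p * n) * x₁          ≤⟨ *-monoˡ-≤ x₁ poly ⟩
    a * e′ * l * x₁                             ≡⟨ regroup a e′ l x₁ ⟩
    e′ * l * (a * x₁)                           ≡⟨ cong (e′ * l *_) rec ⟨
    e′ * l * ((1 + n) * m * x₂ + p * x₀)        ≡⟨ distribute e′ l (1 + n) m p x₀ x₂ ⟩
    m * l * ((1 + n) * e′ * x₂) + e′ * p * (l * x₀) ∎))
  where
  open ≤-Reasoning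
  collect : ∀ m l l′ e e′ p n x → m * l * (l′ * x) + e′ * p * (n * e * x) ≡ (m * l * l′ + e * e′ * p * n) * x
  collect = solve-∀
  regroup : ∀ a e l x → a * e * l * x ≡ e * l * (a * x)
  regroup = solve-∀
  distribute : ∀ e l n m p x y → e * l * (n * m * y + p * x) ≡ m * l * (n * e * y) + e * p * (l * x)
  distribute = solve-∀

-- With the factor `n` on the right instead of in a denominator, the induction can start at 0 ≤ 0:
-- `scaled j 0` is an empty sum.
lower-bound : ∀ j n → boundNum j n * scaled j n ≤ n * boundDen j n * scaled j (suc n)
lower-bound j zero    = ≤-reflexive (*-zeroʳ (boundNum j 0))
lower-bound j (suc n) = bound-transfer ((1 + (j + n)) * (2 + (j + n))) (boundNum j n) (boundNum j (suc n)) (boundDen j n) (boundDen j (suc n)) (lowCoeff j n) (2 * (1 + (j + n)) * midCoeff j n) n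
  {scaled j n} {scaled j (1 + n)} {scaled j (2 + n)}
  (lower-bound j n)
  (recurrence j n)
  (coefficientwise-≤ j n
    ((con 1 ⊕ (X ⊕ Y)) ⊗ (con 2 ⊕ (X ⊕ Y)) ⊗ Lᴱ Y ⊗ Lᴱ (sucᴱ Y) ⊕ Eᴱ Y ⊗ Eᴱ (sucᴱ Y) ⊗ Pᴱ Y ⊗ Y)
    (con 2 ⊗ (con 1 ⊕ (X ⊕ Y)) ⊗ Aᴱ Y ⊗ Eᴱ (sucᴱ Y) ⊗ Lᴱ Y))

-- The first recurrence eliminates `x₀`, the second `x₃`. Multiplied by `scale`, the claim becomes
-- `quartic-<` for `x = x₁` and `y = D * e * x₂`.
ratio-<-transfer : ∀ h g e p q a b D l {x₀ x₁ x₂ x₃} → 0 < x₁ →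
  l * x₁ ≤ D * e * x₂ →
  D * h * x₂ + p * x₀ ≡ a * x₁ →
  g * x₃ + q * x₁ ≡ b * x₂ →
  let α = g * a * e ; β = p * D * D * (q * D) * (e * e * e * e) ; γ = p * D * D * b * (e * e * e) ; δ = g * h in
  α * (l * l * l) + β < γ * l + δ * (l * l * l * l) →
  3 * α * (l * l) ≤ γ + 4 * δ * (l * l * l) →
  α ≤ 2 * δ * l →
  x₂ * x₂ * x₂ * x₀ < x₁ * x₁ * x₁ * x₃
ratio-<-transfer h g e p q a b D l {x₀} {x₁} {x₂} {x₃} x₁>0 bound rec rec′ h₀ h₁ h₂ =
  *-cancelˡ-< scale _ _ (+-cancelʳ-< common _ _ (begin-strict
    scale * (x₂ * x₂ * x₂ * x₀) + common
      ≡⟨ gatherˡ h g e p q D x₀ x₁ x₂ ⟩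
    g * e * (D * e * x₂ * (D * e * x₂) * (D * e * x₂)) * (D * h * x₂ + p * x₀) + β * (x₁ * x₁ * x₁ * x₁)
      ≡⟨ cong (λ s → g * e * (D * e * x₂ * (D * e * x₂) * (D * e * x₂)) * s + β * (x₁ * x₁ * x₁ * x₁)) rec ⟩
    g * e * (D * e * x₂ * (D * e * x₂) * (D * e * x₂)) * (a * x₁) + β * (x₁ * x₁ * x₁ * x₁)
      ≡⟨ cong (_+ β * (x₁ * x₁ * x₁ * x₁)) (regroupˡ g e (D * e * x₂ * (D * e * x₂) * (D * e * x₂)) a x₁) ⟩
    g * a * e * x₁ * (D * e * x₂ * (D * e * x₂) * (D * e * x₂)) + β * (x₁ * x₁ * x₁ * x₁)
      <⟨ quartic-< (g * a * e) β (p * D * D * b * (e * e * e)) (g * h) l x₁>0 bound h₀ h₁ h₂ ⟩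
    p * D * D * b * (e * e * e) * (x₁ * x₁ * x₁) * (D * e * x₂) + g * h * (D * e * x₂ * (D * e * x₂) * (D * e * x₂) * (D * e * x₂))
      ≡⟨ cong (_+ g * h * (D * e * x₂ * (D * e * x₂) * (D * e * x₂) * (D * e * x₂))) (regroupʳ p D b e x₁ x₂) ⟩
    p * D * D * D * (e * e * e * e) * (x₁ * x₁ * x₁) * (b * x₂) + g * h * (D * e * x₂ * (D * e * x₂) * (D * e * x₂) * (D * e * x₂))
      ≡⟨ cong (λ s → p * D * D * D * (e * e * e * e) * (x₁ * x₁ * x₁) * s + g * h * (D * e * x₂ * (D * e * x₂) * (D * e * x₂) * (D * e * x₂))) rec′ ⟨
    p * D * D * D * (e * e * e * e) * (x₁ * x₁ * x₁) * (g * x₃ + q * x₁) + g * h * (D * e * x₂ * (D * e * x₂) * (D * e * x₂) * (D * e * x₂))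
      ≡⟨ gatherʳ h g e p q D x₁ x₂ x₃ ⟩
    scale * (x₁ * x₁ * x₁ * x₃) + common ∎))
  where
  open ≤-Reasoning
  scale = e * e * e * e * g * p * D * D * D
  β = p * D * D * (q * D) * (e * e * e * e)
  -- These are the terms that solving the recurrences for `x₀` and `x₃` would subtract.
  common = g * h * (e * e * e * e) * (D * x₂ * (D * x₂) * (D * x₂) * (D * x₂)) + β * (x₁ * x₁ * x₁ * x₁)
  regroupˡ : ∀ g e c a x → g * e * c * (a * x) ≡ g * a * e * x * c
  regroupˡ = solve-∀
  regroupʳ : ∀ p D b e x y → p * D * D * b * (e * e * e) * (x * x * x) * (D * e * y) ≡ p * D * D * D * (e * e * e * e) * (x * x * x) * (b * y)
  regroupʳ = solve-∀
  gatherˡ : ∀ h g e p q D x₀ x₁ x₂ → e * e * e * e * g * p * D * D * D * (x₂ * x₂ * x₂ * x₀) + (g * h * (e * e * e * e) * (D * x₂ * (D * x₂) * (D * x₂) * (D * x₂)) + p * D * D * (q * D) * (e * e * e * e) * (x₁ * x₁ * x₁ * x₁))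
    ≡ g * e * (D * e * x₂ * (D * e * x₂) * (D * e * x₂)) * (D * h * x₂ + p * x₀) + p * D * D * (q * D) * (e * e * e * e) * (x₁ * x₁ * x₁ * x₁)
  gatherˡ = solve-∀
  gatherʳ : ∀ h g e p q D x₁ x₂ x₃ → p * D * D * D * (e * e * e * e) * (x₁ * x₁ * x₁) * (g * x₃ + q * x₁) + g * h * (D * e * x₂ * (D * e * x₂) * (D * e * x₂) * (D * e * x₂))
    ≡ e * e * e * e * g * p * D * D * D * (x₁ * x₁ * x₁ * x₃) + (g * h * (e * e * e * e) * (D * x₂ * (D * x₂) * (D * x₂) * (D * x₂)) + p * D * D * (q * D) * (e * e * e * e) * (x₁ * x₁ * x₁ * x₁))
  gatherʳ = solve-∀

scaled≡∑ : ∀ j n → scaled j n ≡ ∑ (suc j) (j + n) (dTerm (suc j) (j + n))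
scaled≡∑ j n = cong (partialSum j (j + n)) (sym (m+n∸m≡n j n))

scaled-pos : ∀ j n → 0 < scaled j (suc n)
scaled-pos j n = subst (0 <_) (sym (scaled≡∑ j (suc n))) (∑-pos (dTerm (suc j) (j + suc n)) i≤m (dTerm-pos i≤m))
  where
  i≤m : suc j ≤ j + suc n
  i≤m = subst (suc j ≤_) (sym (+-suc j n)) (s≤s (m≤m+n j n))

-- The claim cross-multiplied, for m = j + n + 2; the powers of 4 hidden in `scaled` balance.
ratio-log-convex : ∀ j n →
  scaled j (2 + n) * scaled j (2 + n) * scaled j (2 + n) * scaled j n
  < scaled j (1 + n) * scaled j (1 + n) * scaled j (1 + n) * scaled j (3 + n)
ratio-log-convex j n = ratio-<-transfer
  ((1 + (j + n)) * (2 + (j + n))) ((2 + n) * ((1 + (j + suc n)) * (2 + (j + suc n))))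
  (boundDen j (suc n)) (lowCoeff j n) (lowCoeff j (suc n)) (2 * (1 + (j + n)) * midCoeff j n) (2 * (1 + (j + suc n)) * midCoeff j (suc n)) (1 + n) (boundNum j (suc n))
  {scaled j n} {scaled j (1 + n)} {scaled j (2 + n)} {scaled j (3 + n)}
  (scaled-pos j n) (lower-bound j (suc n))
  (recurrence j n)
  (recurrence j (suc n))
  -- The summand `con 1` encodes strictness, since `a < b` is `suc a ≤ b`.
  (coefficientwise-≤ j n (con 1 ⊕ (αᴱ ⊗ (l ⊗ l ⊗ l) ⊕ βᴱ)) (γᴱ ⊗ l ⊕ δᴱ ⊗ (l ⊗ l ⊗ l ⊗ l)))
  (coefficientwise-≤ j n (con 3 ⊗ αᴱ ⊗ (l ⊗ l)) (γᴱ ⊕ con 4 ⊗ δᴱ ⊗ (l ⊗ l ⊗ l)))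
  (coefficientwise-≤ j n αᴱ (con 2 ⊗ δᴱ ⊗ l))
  where
  hᴱ gᴱ e p q a b D l αᴱ βᴱ γᴱ δᴱ : Expr
  hᴱ = (con 1 ⊕ (X ⊕ Y)) ⊗ (con 2 ⊕ (X ⊕ Y))
  gᴱ = (con 2 ⊕ Y) ⊗ ((con 1 ⊕ (X ⊕ sucᴱ Y)) ⊗ (con 2 ⊕ (X ⊕ sucᴱ Y)))
  e = Eᴱ (sucᴱ Y)
  p = Pᴱ Y
  q = Pᴱ (sucᴱ Y)
  a = con 2 ⊗ (con 1 ⊕ (X ⊕ Y)) ⊗ Aᴱ Y
  b = con 2 ⊗ (con 1 ⊕ (X ⊕ sucᴱ Y)) ⊗ Aᴱ (sucᴱ Y)
  D = sucᴱ Y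
  l = Lᴱ (sucᴱ Y)
  αᴱ = gᴱ ⊗ a ⊗ e
  βᴱ = p ⊗ D ⊗ D ⊗ (q ⊗ D) ⊗ (e ⊗ e ⊗ e ⊗ e)
  γᴱ = p ⊗ D ⊗ D ⊗ b ⊗ (e ⊗ e ⊗ e)
  δᴱ = gᴱ ⊗ hᴱ

-- Passage to ℚ

fromℚᵘ-homo-* : ∀ p q → ℚ.fromℚᵘ (p ℚᵘ.* q) ≡ ℚ.fromℚᵘ p ℚ.* ℚ.fromℚᵘ q
fromℚᵘ-homo-* p q = ℚ.toℚᵘ-injective (ℚᵘ.≃-trans (ℚ.toℚᵘ-fromℚᵘ (p ℚᵘ.* q))
  (ℚᵘ.≃-trans (ℚᵘ.*-cong (ℚᵘ.≃-sym (ℚ.toℚᵘ-fromℚᵘ p)) (ℚᵘ.≃-sym (ℚ.toℚᵘ-fromℚᵘ q)))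
    (ℚᵘ.≃-sym (ℚ.toℚᵘ-homo-* (ℚ.fromℚᵘ p) (ℚ.fromℚᵘ q)))))

/-*-/ : ∀ a b c d .{{_ : NonZero b}} .{{_ : NonZero d}} →
  (ℤ.+ a ℚ./ b) ℚ.* (ℤ.+ c ℚ./ d) ≡ ℚ._/_ (ℤ.+ (a * c)) (b * d) {{m*n≢0 b d}}
/-*-/ a (suc b) c (suc d) = trans (sym (fromℚᵘ-homo-* (mkℚᵘ (ℤ.+ a) b) (mkℚᵘ (ℤ.+ c) d)))
  -- `mkℚᵘ` stores the denominator minus one: `d + b * suc d` precedes `suc b * suc d`.
  (cong (λ n → ℚ.fromℚᵘ (mkℚᵘ n (d + b * suc d))) (sym (ℤ.pos-* a c)))

/-monoˡ-< : ∀ {a b} n .{{_ : NonZero n}} → a < b → ℤ.+ a ℚ./ n ℚ.< ℤ.+ b ℚ./ n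
/-monoˡ-< {a} {b} (suc n) a<b = ℚ.toℚᵘ-cancel-<
  (ℚᵘ.<-respˡ-≃ (ℚᵘ.≃-sym (ℚ.toℚᵘ-fromℚᵘ (mkℚᵘ (ℤ.+ a) n)))
    (ℚᵘ.<-respʳ-≃ (ℚᵘ.≃-sym (ℚ.toℚᵘ-fromℚᵘ (mkℚᵘ (ℤ.+ b) n)))
      (*<* (ℤ.*-monoʳ-<-pos (ℤ.+ suc n) (ℤ.+<+ a<b)))))

-- Multiplying by `r`, that is b²ca, clears every denominator, and a nonnegative factor cancels from
-- a strict inequality.
÷-square-< : ∀ a b c e .{{_ : ℚ.NonNegative a}} .{{_ : ℚ.NonNegative b}} .{{_ : ℚ.NonNegative c}}
  .{{_ : ℚ.NonZero a}} .{{_ : ℚ.NonZero b}} .{{_ : ℚ.NonZero c}} →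
  a ℚ.* a ℚ.* a ℚ.* c ℚ.< b ℚ.* b ℚ.* b ℚ.* e → (a ℚ.÷ b) ℚ.* (a ℚ.÷ b) ℚ.< (b ℚ.÷ c) ℚ.* (e ℚ.÷ a)
÷-square-< a b c e h = ℚ.*-cancelˡ-<-nonNeg r {{r-nonNeg}} (subst₂ ℚ._<_ (sym left) (sym right) h)
  where
  open +-*-Solver
  r = b ℚ.* b ℚ.* (c ℚ.* a)
  r-nonNeg : ℚ.NonNegative r
  r-nonNeg = ℚ.nonNeg*nonNeg⇒nonNeg (b ℚ.* b) {{ℚ.nonNeg*nonNeg⇒nonNeg b b}} (c ℚ.* a) {{ℚ.nonNeg*nonNeg⇒nonNeg c a}}
  left : r ℚ.* ((a ℚ.÷ b) ℚ.* (a ℚ.÷ b)) ≡ a ℚ.* a ℚ.* a ℚ.* c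
  left = trans
    (solve 4 (λ a b c i → b :* b :* (c :* a) :* ((a :* i) :* (a :* i)) := (b :* i) :* (b :* i) :* (a :* a :* a :* c)) refl a b c (ℚ.1/ b))
    (trans (cong (λ x → x ℚ.* x ℚ.* (a ℚ.* a ℚ.* a ℚ.* c)) (ℚ.*-inverseʳ b)) (ℚ.*-identityˡ (a ℚ.* a ℚ.* a ℚ.* c)))
  right : r ℚ.* ((b ℚ.÷ c) ℚ.* (e ℚ.÷ a)) ≡ b ℚ.* b ℚ.* b ℚ.* e
  right = trans
    (solve 6 (λ a b c e i k → b :* b :* (c :* a) :* ((b :* i) :* (e :* k)) := (c :* i) :* (a :* k) :* (b :* b :* b :* e)) refl a b c e (ℚ.1/ c) (ℚ.1/ a))
    (trans (cong₂ (λ x y → x ℚ.* y ℚ.* (b ℚ.* b ℚ.* b ℚ.* e)) (ℚ.*-inverseʳ c) (ℚ.*-inverseʳ a)) (ℚ.*-identityˡ (b ℚ.* b ℚ.* b ℚ.* e)))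

cube-/-*-/ : ∀ a b c d .{{_ : NonZero b}} .{{_ : NonZero d}} .{{_ : NonZero (b * b * b * d)}} →
  (ℤ.+ a ℚ./ b) ℚ.* (ℤ.+ a ℚ./ b) ℚ.* (ℤ.+ a ℚ./ b) ℚ.* (ℤ.+ c ℚ./ d) ≡ ℤ.+ (a * a * a * c) ℚ./ (b * b * b * d)
cube-/-*-/ a b c d = begin
  x ℚ.* x ℚ.* x ℚ.* y                                       ≡⟨ cong (λ z → z ℚ.* x ℚ.* y) (/-*-/ a b a b) ⟩
  (ℤ.+ (a * a) ℚ./ (b * b)) ℚ.* x ℚ.* y                       ≡⟨ cong (ℚ._* y) (/-*-/ (a * a) (b * b) a b) ⟩
  (ℤ.+ (a * a * a) ℚ./ (b * b * b)) ℚ.* y                     ≡⟨ /-*-/ (a * a * a) (b * b * b) c d ⟩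
  ℤ.+ (a * a * a * c) ℚ./ (b * b * b * d)                     ∎
  where
  open ≡-Reasoning
  x = ℤ.+ a ℚ./ b
  y = ℤ.+ c ℚ./ d
  instance
    bb≢0 : NonZero (b * b)
    bb≢0 = m*n≢0 b b
    bbb≢0 : NonZero (b * b * b)
    bbb≢0 = m*n≢0 (b * b) b

d-ratio-log-convex : ∀ j n → let dⱼ = λ k → d (suc j) (j + k) in
  dⱼ (2 + n) ℚ.* dⱼ (2 + n) ℚ.* dⱼ (2 + n) ℚ.* dⱼ n ℚ.< dⱼ (1 + n) ℚ.* dⱼ (1 + n) ℚ.* dⱼ (1 + n) ℚ.* dⱼ (3 + n)
d-ratio-log-convex j n = subst₂ ℚ._<_
  (sym (cube-/-*-/ (N (2 + n)) (W (2 + n)) (N n) (W n)))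
  (trans (ℚ./-cong {ℤ.+ (N (1 + n) * N (1 + n) * N (1 + n) * N (3 + n))} refl denominators) (sym (cube-/-*-/ (N (1 + n)) (W (1 + n)) (N (3 + n)) (W (3 + n)))))
  (/-monoˡ-< (W (2 + n) * W (2 + n) * W (2 + n) * W n) numerators)
  where
  N W : ℕ → ℕ
  N k = ∑ (suc j) (j + k) (dTerm (suc j) (j + k))
  W k = 2 ^ (2 * (j + k))
  instance
    W≢0 : ∀ {k} → NonZero (W k)
    W≢0 {k} = m^n≢0 2 (2 * (j + k))
    W³W≢0 : ∀ {k l} → NonZero (W k * W k * W k * W l)
    W³W≢0 {k} {l} = m*n≢0 (W k * W k * W k) (W l) {{m*n≢0 (W k * W k) (W k) {{m*n≢0 (W k) (W k)}}}}
  W-suc : ∀ k → W (suc k) ≡ 4 * W k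
  W-suc k = trans (cong (2 ^_) (exponent j k)) (^-distribˡ-+-* 2 2 (2 * (j + k)))
    where
    exponent : ∀ j k → 2 * (j + suc k) ≡ 2 + 2 * (j + k)
    exponent = solve-∀
  -- Both exponents of 4 exceed that of `W n` to the fourth power by 6, as 3·2 + 0 = 3·1 + 3.
  denominators : W (2 + n) * W (2 + n) * W (2 + n) * W n ≡ W (1 + n) * W (1 + n) * W (1 + n) * W (3 + n)
  denominators rewrite W-suc (2 + n) | W-suc (1 + n) | W-suc n = powers (W n)
    where
    powers : ∀ w → 4 * (4 * w) * (4 * (4 * w)) * (4 * (4 * w)) * w ≡ 4 * w * (4 * w) * (4 * w) * (4 * (4 * (4 * w)))
    powers = solve-∀
  numerators : N (2 + n) * N (2 + n) * N (2 + n) * N n < N (1 + n) * N (1 + n) * N (1 + n) * N (3 + n)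
  numerators = subst₂ _<_
    (cong₂ (λ a c → a * a * a * c) (scaled≡∑ j (2 + n)) (scaled≡∑ j n))
    (cong₂ (λ b e → b * b * b * e) (scaled≡∑ j (1 + n)) (scaled≡∑ j (3 + n)))
    (ratio-log-convex j n)

d-nonNeg : ∀ i m → ℚ.NonNegative (d i m)
d-nonNeg i m = ℚ.normalize-nonNeg (∑ i m (dTerm i m)) (2 ^ (2 * m)) {{m^n≢0 2 (2 * m)}}

theorem3p1 : (i m : ℕ) → 1 ≤ i → (h : i + 2 ≤ m) →
    dRatio i m (m ∸ 1) (i+2≤m⇒i≤m∸1 h) ℚ.* dRatio i m (m ∸ 1) (i+2≤m⇒i≤m∸1 h)
    ℚ.< dRatio i (m ∸ 1) (m ∸ 2) (i+2≤m⇒i≤m∸2 h) ℚ.* dRatio i (m + 1) m (i+2≤m⇒i≤m h)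
theorem3p1 i@(suc j) m _ h =
  ÷-square-< (d i m) (d i (m ∸ 1)) (d i (m ∸ 2)) (d i (m + 1))
    {{d-nonNeg i m}} {{d-nonNeg i (m ∸ 1)}} {{d-nonNeg i (m ∸ 2)}}
    {{d-nonZero {i} {m} (i+2≤m⇒i≤m {i} {m} h)}}
    {{d-nonZero {i} {m ∸ 1} (i+2≤m⇒i≤m∸1 {i} {m} h)}}
    {{d-nonZero {i} {m ∸ 2} (i+2≤m⇒i≤m∸2 {i} {m} h)}}
    (subst₂ ℚ._<_
      (cong₂ (λ a c → d i a ℚ.* d i a ℚ.* d i a ℚ.* d i c) (sym m≡) (sym (cong (_∸ 2) m≡2+)))
      (cong₂ (λ b e → d i b ℚ.* d i b ℚ.* d i b ℚ.* d i e) (sym (cong (_∸ 1) m≡1+)) (trans (+-suc j (2 + n)) (trans (cong suc (sym m≡)) (+-comm 1 m))))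
      (d-ratio-log-convex j n))
  where
  n : ℕ
  -- With this choice m - 2, m - 1, m and m + 1 are `j + n` up to `j + (3 + n)`.
  n = m ∸ (j + 2)
  m≡ : m ≡ j + (2 + n)
  m≡ = trans (sym (m+[n∸m]≡n (≤-trans (n≤1+n (j + 2)) h))) (+-assoc j 2 n)
  m≡1+ : m ≡ suc (j + (1 + n))
  m≡1+ = trans m≡ (+-suc j (1 + n))
  m≡2+ : m ≡ suc (suc (j + n))
  m≡2+ = trans m≡1+ (cong suc (+-suc j n))
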